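{- Let $H$ be the directed graph with vertex set $\{0,1,2,3\}$ and edge set $\{(0,1),(0,2),(1,3),(2,3)\}$. In the directed CONGEST model in which each node broadcasts at most $B$ bits per round, any (randomized) algorithm for testing $H$-freeness of directed network graphs requires $\Omega\big(1/(B\epsilon)\big)$ rounds.
   Context: Directed CONGEST model: the network is a directed graph $G$; each node knows only its incoming edges. Computation is synchronous; in each round every node broadcasts a single message of at most $B$ bits, which is received by all of its out-neighbors (the sending node does not know who they are). Nodes may use randomness. $G$ is $H$-free if it has no (not necessarily induced) directed subgraph isomorphic to $H$. $G$ with edge set $E$ is $\epsilon$-far from $H$-free if at least $\epsilon|E|$ edges must be added to or removed from $E$ to obtain an $H$-free graph. Testing $H$-freeness with parameter $\epsilon$: if $G$ is $H$-free then with probability at least $2/3$ all nodes accept; if $G$ is $\epsilon$-far from $H$-free then with probability at least $2/3$ some node rejects. -}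

module Defs where

open import Level using (0ℓ)
open import Data.Bool using (Bool; true; false; if_then_else_; _≟_)
open import Data.Fin using (Fin; finToFun)
open import Data.Fin.Patterns using (0F; 1F; 2F)
open import Data.Fin.Properties using (all?; any?)
open import Data.Fin.Subset using (Subset; _∈_; _∉_; _∪_; _─_; ⁅_⁆; ∣_∣; ⊥)
open import Data.Fin.Subset.Properties using (_∈?_)
open import Data.Integer using (+_)
open import Data.Maybe using (Maybe; just; nothing)
open import Data.Nat as ℕ using (ℕ; zero; suc; NonZero)
open import Data.Nat.Properties using (m^n≢0)
open import Data.Product using (_×_; ∃-syntax)
open import Data.Rational as ℚ using (ℚ; Positive)
open import Data.Rational.Properties using (normalize-pos; pos*pos⇒pos; pos⇒nonZero)
open import Data.Vec using (Vec; []; _∷_; lookup; tabulate; sum; count; allFin)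
open import Data.Vec.Bounded using (Vec≤)
open import Function.Definitions using (Injective)
open import Relation.Binary.PropositionalEquality using (_≡_)
open import Relation.Nullary using (¬_; Dec; does; ¬?)
open import Relation.Nullary.Decidable using (toWitness)
open import Relation.Unary using (Pred; Decidable)

fromℕ : ℕ → ℚ
fromℕ m = + m ℚ./ 1

fromℕ-pos : ∀ m .{{_ : NonZero m}} → Positive (fromℕ m)
fromℕ-pos (suc m) = normalize-pos (suc m) 1

1/[_*_] : (B : ℕ) (ε : ℚ) .{{_ : NonZero B}} .{{_ : Positive ε}} → ℚ
1/[ B * ε ] = (ℚ.1/ (fromℕ B ℚ.* ε)) {{pos⇒nonZero (fromℕ B ℚ.* ε) {{positive}}}}
  where
  positive : Positive (fromℕ B ℚ.* ε)
  positive = pos*pos⇒pos (fromℕ B) {{fromℕ-pos B}} ε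

-- A simple directed graph on Fin n, given by its in-neighbourhoods: (u , v) is
-- an edge iff u ∈ inNbrs v.  Antiparallel edges are allowed, loops are not.
record Digraph (n : ℕ) : Set where
  field
    adj      : Vec (Subset n) n
    loopless : ∀ v → v ∉ lookup adj v

  inNbrs : Fin n → Subset n
  inNbrs = lookup adj

  Edge : Fin n → Fin n → Set
  Edge u v = u ∈ inNbrs v

  ∣E∣ : ℕ
  ∣E∣ = sum (tabulate λ v → ∣ inNbrs v ∣)

open Digraph public using (inNbrs; Edge; ∣E∣)

H : Digraph 4
H = record { adj = adj ; loopless = loopless }
  where
  adj : Vec (Subset 4) 4
  adj = ⊥ ∷ ⁅ 0F ⁆ ∷ ⁅ 0F ⁆ ∷ (⁅ 1F ⁆ ∪ ⁅ 2F ⁆) ∷ []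

  loopless : ∀ v → v ∉ lookup adj v
  loopless = toWitness {a? = all? λ v → ¬? (v ∈? lookup adj v)} _

-- G has a, not necessarily induced, subgraph isomorphic to F.
Contains : ∀ {m n} → Digraph m → Digraph n → Set
Contains {m} {n} F G =
  ∃[ f ] Injective {A = Fin m} {B = Fin n} _≡_ _≡_ f
       × (∀ u v → Edge F u v → Edge G (f u) (f v))

Free : ∀ {m n} → Digraph m → Digraph n → Set
Free F G = ¬ Contains F G

-- The number of edges removed plus the number of edges added when passing from
-- G to G′.
dist : ∀ {n} → Digraph n → Digraph n → ℕ
dist G G′ = sum (tabulate λ v →
  ∣ inNbrs G v ─ inNbrs G′ v ∣ ℕ.+ ∣ inNbrs G′ v ─ inNbrs G v ∣)

-- Without the condition that G has an edge, the edgeless graph would be at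
-- once F-free and ε-far from F-free, and no tester could exist.
Far : ∀ {m n} → ℚ → Digraph m → Digraph n → Set
Far {n = n} ε F G =
    NonZero (∣E∣ G)
  × ((G′ : Digraph n) → Free F G′ → ε ℚ.* fromℕ (∣E∣ G) ℚ.≤ fromℕ (dist G G′))

Message : ℕ → Set
Message B = Vec≤ Bool B

-- The messages that a node receives in a round, indexed by sender, with
-- nothing at the nodes that are not in-neighbours.
Inbox : ℕ → ℕ → Set
Inbox n B = Vec (Maybe (Message B)) n

-- A randomized T-round algorithm for n-node networks with bandwidth B.  The
-- vertices serve as the identifiers.  A node initially knows its identifier,
-- its in-neighbours and a private random seed, uniform on Fin seeds, that
-- contains all the randomness it uses.
record Algorithm (n B T : ℕ) : Set₁ where
  field
    seeds       : ℕ
    {{seeds≢0}} : NonZero seeds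
    State       : Set
    init        : Fin n → Subset n → Fin seeds → State
    send        : State → Message B
    receive     : State → Inbox n B → State
    accept      : State → Bool

  module _ (G : Digraph n) (seed : Fin n → Fin seeds) where

    state : ℕ → Fin n → State
    inbox : ℕ → Fin n → Inbox n B

    state zero    v = init v (inNbrs G v) (seed v)
    state (suc t) v = receive (state t v) (inbox t v)

    inbox t v = tabulate λ u →
      if does (u ∈? inNbrs G v) then just (send (state t u)) else nothing

    output : Fin n → Bool
    output v = accept (state T v)

    AllAccept : Set
    AllAccept = ∀ v → output v ≡ true

    SomeRejects : Set
    SomeRejects = ∃[ v ] output v ≡ false

    allAccept? : Dec AllAccept
    allAccept? = all? λ v → output v ≟ true

    someRejects? : Dec SomeRejects
    someRejects? = any? λ v → output v ≟ false

-- Probability when the n nodes draw independent, uniform seeds from Fin s: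
-- finToFun is a bijection from Fin (s ^ n) onto the seed assignments.
Pr : ∀ {n s} .{{_ : NonZero s}} {P : Pred (Fin n → Fin s) 0ℓ} → Decidable P → ℚ
Pr {n} {s} P? =
  (+ count (λ ω → P? (finToFun ω)) (allFin (s ℕ.^ n)) ℚ./ (s ℕ.^ n)) {{m^n≢0 s n}}

record Tests {m n B T} (A : Algorithm n B T) (F : Digraph m) (ε : ℚ) : Set where
  open Algorithm A
  field
    complete : ∀ G → Free F G  → + 2 ℚ./ 3 ℚ.≤ Pr (allAccept? G)
    sound    : ∀ G → Far ε F G → + 2 ℚ./ 3 ℚ.≤ Pr (someRejects? G)

{-# OPTIONS --safe #-}
module Submission where

-- The networks have a sink fed by two vertices, Alice and Bob, who are fed by
-- sources: Alice by a set X ⊆ [k] of them and Bob by a single source i.  Such a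
-- network contains H iff i ∈ X, and then it is ε-far from H-free because it
-- has at most k + 3 ≤ 1/ε edges.  The sink sees Alice's input only through her
-- messages, and the private coins of the sources act as shared randomness, so
-- a tester is a one-way protocol for INDEX of (B + 1)T + 1 bits: the messages
-- and Alice's own verdict.  If y is the guess of X made from a message, the
-- moment Σ_X 2^(number of agreements of X and y) is 3^k; convexity of 2^a turns
-- success probability 2/3 into 2^k · 2^(2k/3) ≤ (number of messages) · 3^k, so
-- the number of messages is exponential in k.

open import Defs
open import Data.Bool as Bool using (Bool; true; false; if_then_else_; not)
open import Data.Empty using (⊥-elim)
open import Data.Fin using (Fin; zero; suc; _↑ˡ_; finToFun)
open import Data.Fin.Patterns using (0F; 1F; 2F; 3F)
open import Data.Fin.Properties using (any?)
open import Data.Fin.Subset using (Subset; inside; outside; _∈_; _∉_; _─_; ⁅_⁆; ∣_∣; ⊥)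
open import Data.Fin.Subset.Properties
  using (_∈?_; ∉⊥; ∣⊥∣≡0; ∣⁅x⁆∣≡1; x∈⁅x⁆; x∈⁅y⁆⇒x≡y; p⊆q⇒∣p∣≤∣q∣; x∈p∧x∉q⇒x∈p─q)
import Data.Integer as ℤ
import Data.Integer.Properties as ℤ
open import Data.List as List
  using (List; []; _∷_; length; map; allFin; cartesianProduct; cartesianProductWith)
open import Data.List.Membership.Propositional using () renaming (_∈_ to _∈ˡ_)
open import Data.List.Membership.Propositional.Properties
  using (∈-map⁺; ∈-++⁺ˡ; ∈-++⁺ʳ; ∈-cartesianProductWith⁺)
open import Data.List.Properties
  using (map-++; map-∘; map-tabulate; length-++; length-map; length-tabulate)
open import Data.List.Relation.Unary.Any using (here; there)
open import Data.Maybe using (Maybe; just; nothing)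
open import Data.Nat as ℕ using (ℕ; zero; suc; NonZero; z≤n; s≤s)
open import Data.Nat.DivMod using (m/n*n≤m; m≡m%n+[m/n]*n; m%n<n)
open import Data.Nat.ListAction using (sum)
open import Data.Nat.ListAction.Properties using (sum-++)
import Data.Nat.Properties as ℕ
open import Data.Nat.Tactic.RingSolver using (solve-∀)
open import Data.Product using (∃-syntax; _×_; _,_)
open import Data.Rational as ℚ using (ℚ; mkℚ; Positive; toℚᵘ)
import Data.Rational.Properties as ℚ
open import Data.Rational.Unnormalised as ℚᵘ using (mkℚᵘ; *≡*; *≤*)
import Data.Rational.Unnormalised.Properties as ℚᵘ
open import Data.Sum using (inj₁; inj₂)
open import Data.Vec as Vec using (Vec; []; _∷_; here; there; lookup; tabulate; count; replicate)
open import Data.Vec.Bounded as Vec≤ using (fromVec; ≤-cast; isBounded)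
open import Data.Vec.Properties
  using (lookup-replicate; tabulate-cong; lookup-++ˡ; lookup⇒[]=; []=⇒lookup)
open import Function using (_∘_; id; mk⇔)
open import Function.Definitions using (Injective)
open import Level using (Level; 0ℓ)
open import Relation.Binary.PropositionalEquality
open import Relation.Nullary using (¬_; Dec; does; yes; no; contradiction; ¬?)
open import Relation.Nullary.Decidable using (does-⇔)
open import Relation.Unary using (Pred; Decidable)

-- The INDEX problem

module Index where
  open import Data.Nat
  open import Data.Nat.Properties
  open import Data.List using (_++_)

  private
    variable
      a b c : Level
      A : Set a
      B : Set b
      C : Set c

  -- Finite sums over lists.

  ∑ : List A → (A → ℕ) → ℕ
  ∑ xs f = sum (map f xs)

  syntax ∑ xs (λ x → e) = ∑[ x ← xs ] e

  ∑-mono : ∀ (xs : List A) {f g : A → ℕ} → (∀ x → f x ≤ g x) → ∑ xs f ≤ ∑ xs g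
  ∑-mono []       f≤g = z≤n
  ∑-mono (x ∷ xs) f≤g = +-mono-≤ (f≤g x) (∑-mono xs f≤g)

  ∑-cong : ∀ (xs : List A) {f g : A → ℕ} → (∀ x → f x ≡ g x) → ∑ xs f ≡ ∑ xs g
  ∑-cong []       f≗g = refl
  ∑-cong (x ∷ xs) f≗g = cong₂ _+_ (f≗g x) (∑-cong xs f≗g)

  ∑-const : ∀ (xs : List A) k → ∑[ _ ← xs ] k ≡ length xs * k
  ∑-const []       k = refl
  ∑-const (x ∷ xs) k = cong (k +_) (∑-const xs k)

  ∑-+ : ∀ (xs : List A) (f g : A → ℕ) → ∑[ x ← xs ] (f x + g x) ≡ ∑ xs f + ∑ xs g
  ∑-+ []       f g = refl
  ∑-+ (x ∷ xs) f g rewrite ∑-+ xs f g = +-interchange (f x) (g x) (∑ xs f) (∑ xs g)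
    where
    +-interchange : ∀ a b c d → (a + b) + (c + d) ≡ (a + c) + (b + d)
    +-interchange = solve-∀

  ∑-*ˡ : ∀ (xs : List A) k (f : A → ℕ) → ∑[ x ← xs ] (k * f x) ≡ k * ∑ xs f
  ∑-*ˡ []       k f = sym (*-zeroʳ k)
  ∑-*ˡ (x ∷ xs) k f rewrite ∑-*ˡ xs k f = sym (*-distribˡ-+ k (f x) (∑ xs f))

  ∑-swap : ∀ (xs : List A) (ys : List B) (f : A → B → ℕ) →
           ∑[ x ← xs ] ∑[ y ← ys ] f x y ≡ ∑[ y ← ys ] ∑[ x ← xs ] f x y
  ∑-swap []       ys f = sym (trans (∑-const ys 0) (*-zeroʳ (length ys)))
  ∑-swap (x ∷ xs) ys f =
    trans (cong (∑ ys (f x) +_) (∑-swap xs ys f))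
          (sym (∑-+ ys (f x) (λ y → ∑[ x ← xs ] f x y)))

  ∑-++ : ∀ (xs ys : List A) (f : A → ℕ) → ∑ (xs ++ ys) f ≡ ∑ xs f + ∑ ys f
  ∑-++ xs ys f = trans (cong sum (map-++ f xs ys)) (sum-++ (map f xs) (map f ys))

  ∑-map : ∀ (g : A → B) (xs : List A) (f : B → ℕ) → ∑ (map g xs) f ≡ ∑ xs (f ∘ g)
  ∑-map g xs f = cong sum (sym (map-∘ xs))

  ∑-product : ∀ (g : A → B → C) (xs : List A) (ys : List B) (f : C → ℕ) →
              ∑ (cartesianProductWith g xs ys) f ≡ ∑[ x ← xs ] ∑[ y ← ys ] f (g x y)
  ∑-product g []       ys f = refl
  ∑-product g (x ∷ xs) ys f =
    trans (∑-++ (map (g x) ys) (cartesianProductWith g xs ys) f)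
          (cong₂ _+_ (∑-map (g x) ys f) (∑-product g xs ys f))

  ∑-allFin : ∀ k (f : Fin (suc k) → ℕ) → ∑ (allFin (suc k)) f ≡ f zero + ∑ (allFin k) (f ∘ suc)
  ∑-allFin k f = cong (λ ns → f zero + sum ns)
    (trans (map-tabulate suc f) (sym (map-tabulate (λ i → i) (f ∘ suc))))

  f[x]≤∑ : ∀ {xs : List A} {x} (f : A → ℕ) → x ∈ˡ xs → f x ≤ ∑ xs f
  f[x]≤∑ f (here refl) = m≤m+n _ _
  f[x]≤∑ f (there x∈xs) = ≤-trans (f[x]≤∑ f x∈xs) (m≤n+m _ _)

  length-product : ∀ (g : A → B → C) (xs : List A) (ys : List B) →
                   length (cartesianProductWith g xs ys) ≡ length xs * length ys
  length-product g []       ys = refl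
  length-product g (x ∷ xs) ys =
    trans (length-++ (map (g x) ys)) (cong₂ _+_ (length-map (g x) ys) (length-product g xs ys))

  -- Words over a finite alphabet and their agreement counts.

  words : List A → ∀ k → List (Vec A k)
  words xs zero    = [] ∷ []
  words xs (suc k) = cartesianProductWith _∷_ xs (words xs k)

  length-words : ∀ (xs : List A) k → length (words xs k) ≡ length xs ^ k
  length-words xs zero    = refl
  length-words xs (suc k) =
    trans (length-product _∷_ xs (words xs k)) (cong (length xs *_) (length-words xs k))

  ∈-words : ∀ {xs : List A} → (∀ x → x ∈ˡ xs) → ∀ {k} (w : Vec A k) → w ∈ˡ words xs k
  ∈-words ∈xs []      = here refl
  ∈-words ∈xs (x ∷ w) = ∈-cartesianProductWith⁺ _∷_ (∈xs x) (∈-words ∈xs w)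

  bools : List Bool
  bools = true ∷ false ∷ []

  ∈-bools : ∀ b → b ∈ˡ bools
  ∈-bools true  = here refl
  ∈-bools false = there (here refl)

  match : Bool → Bool → ℕ
  match x y = if does (x Bool.≟ y) then 1 else 0

  agree : ∀ {k} → Vec Bool k → (Fin k → Bool) → ℕ
  agree {k} X y = ∑[ i ← allFin k ] match (lookup X i) (y i)

  -- The sum factorises over the bits. At each position one value of the bit agrees with `y` and
  -- contributes 2, the other contributes 1, which gives a factor 3 whatever `y` is.
  ∑-2^agree : ∀ k (y : Fin k → Bool) → ∑[ X ← words bools k ] (2 ^ agree X y) ≡ 3 ^ k
  ∑-2^agree zero    y = refl
  ∑-2^agree (suc k) y = begin
    ∑[ X ← words bools (suc k) ] (2 ^ agree X y)
      ≡⟨ ∑-product _∷_ bools (words bools k) _ ⟩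
    ∑[ x ← bools ] ∑[ X ← words bools k ] (2 ^ agree (x ∷ X) y)
      ≡⟨ ∑-cong bools (λ x → ∑-cong (words bools k) (λ X → split x X)) ⟩
    ∑[ x ← bools ] ∑[ X ← words bools k ] (2 ^ match x (y zero) * 2 ^ agree X (y ∘ suc))
      ≡⟨ ∑-cong bools (λ x → ∑-*ˡ (words bools k) (2 ^ match x (y zero)) (λ X → 2 ^ agree X (y ∘ suc))) ⟩
    ∑[ x ← bools ] (2 ^ match x (y zero) * ∑[ X ← words bools k ] (2 ^ agree X (y ∘ suc)))
      ≡⟨ ∑-cong bools (λ x → cong (2 ^ match x (y zero) *_) (∑-2^agree k (y ∘ suc))) ⟩
    ∑[ x ← bools ] (2 ^ match x (y zero) * 3 ^ k)
      ≡⟨ last-bit (y zero) (3 ^ k) ⟩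
    3 * 3 ^ k ∎
    where
    open ≡-Reasoning
    split : ∀ x X → 2 ^ agree (x ∷ X) y ≡ 2 ^ match x (y zero) * 2 ^ agree X (y ∘ suc)
    split x X = trans (cong (2 ^_) (∑-allFin k (λ i → match (lookup (x ∷ X) i) (y i))))
                      (^-distribˡ-+-* 2 (match x (y zero)) (agree X (y ∘ suc)))

    last-bit : ∀ b m → ∑[ x ← bools ] (2 ^ match x b * m) ≡ 3 * m
    last-bit true  = 2m+m
      where
      2m+m : ∀ m → 2 * m + (1 * m + 0) ≡ 3 * m
      2m+m = solve-∀
    last-bit false = m+2m
      where
      m+2m : ∀ m → 1 * m + (2 * m + 0) ≡ 3 * m
      m+2m = solve-∀

  -- The tangent-like bound 1 + d ≤ 2 ^ d at the integer d = a − t, with both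
  -- sides moved so that no subtraction occurs.
  2^-convex : ∀ t a → 2 ^ t * (1 + a) ≤ 2 ^ a + t * 2 ^ t
  2^-convex t a with t ≤? a
  ... | no t≰a = begin
    2 ^ t * (1 + a)    ≤⟨ *-monoʳ-≤ (2 ^ t) (≰⇒> t≰a) ⟩
    2 ^ t * t          ≡⟨ *-comm (2 ^ t) t ⟩
    t * 2 ^ t          ≤⟨ m≤n+m _ _ ⟩
    2 ^ a + t * 2 ^ t  ∎
    where open ≤-Reasoning
  ... | yes t≤a with d , refl ← m≤n⇒∃[o]m+o≡n t≤a = begin
    2 ^ t * (1 + (t + d))          ≡⟨ rearrange (2 ^ t) t d ⟩
    2 ^ t * (1 + d) + t * 2 ^ t    ≤⟨ +-monoˡ-≤ _ (*-monoʳ-≤ (2 ^ t) (m<2^m d)) ⟩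
    2 ^ t * 2 ^ d + t * 2 ^ t      ≡⟨ cong (_+ t * 2 ^ t) (^-distribˡ-+-* 2 t d) ⟨
    2 ^ (t + d) + t * 2 ^ t        ∎
    where
    open ≤-Reasoning
    rearrange : ∀ x t d → x * (1 + (t + d)) ≡ x * (1 + d) + t * x
    rearrange = solve-∀
    m<2^m : ∀ m → m < 2 ^ m
    m<2^m zero    = s≤s z≤n
    m<2^m (suc m) = begin
      2 + m          ≤⟨ s≤s (m<2^m m) ⟩
      1 + 2 ^ m      ≤⟨ +-monoˡ-≤ (2 ^ m) (m^n>0 2 m) ⟩
      2 ^ m + 2 ^ m  ≡⟨ cong (2 ^ m +_) (+-identityʳ (2 ^ m)) ⟨
      2 * 2 ^ m      ∎

  -- INDEX needs long messages: ω is the shared randomness, the encoder sees X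
  -- and the decoder must recover each bit of X with probability at least 2/3.
  index-bound :
    ∀ j {W : Set a} {C : Set b} (Ω : List W) .{{_ : NonZero (length Ω)}} (codes : List C) →
    (∀ c → c ∈ˡ codes) →
    (encode : W → Vec Bool (3 * j) → C) (decode : W → C → Fin (3 * j) → Bool) →
    (∀ X i → 2 * length Ω ≤ 3 * ∑[ ω ← Ω ] match (lookup X i) (decode ω (encode ω X) i)) →
    2 ^ (2 * j) * 2 ^ (3 * j) ≤ length codes * 3 ^ (3 * j)
  index-bound j {W} {C} Ω codes ∈codes encode decode correct =
    -- The sum of `2 ^ score ω X` over all `X` and `ω` is bounded below by `average` and above by
    -- the moments of the possible guesses.
    *-cancelˡ-≤ S (begin
    S * (2 ^ t * 2 ^ k)
      ≡⟨ rearrange S (2 ^ t) (2 ^ k) ⟩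
    2 ^ k * (2 ^ t * S)
      ≡⟨ cong (_* (2 ^ t * S)) (length-words bools k) ⟨
    length cube * (2 ^ t * S)
      ≡⟨ ∑-const cube _ ⟨
    ∑[ X ← cube ] (2 ^ t * S)
      ≤⟨ ∑-mono cube average ⟩
    ∑[ X ← cube ] ∑[ ω ← Ω ] (2 ^ score ω X)
      ≡⟨ ∑-swap cube Ω _ ⟩
    ∑[ ω ← Ω ] ∑[ X ← cube ] (2 ^ score ω X)
      -- The code sent depends on `X`. Summing over all codes instead makes the guess independent of
      -- `X`, so that `∑-2^agree` applies, at the cost of the factor `length codes`.
      ≤⟨ ∑-mono Ω (λ ω → ∑-mono cube (λ X →
           f[x]≤∑ (λ c → 2 ^ agree X (decode ω c)) (∈codes (encode ω X)))) ⟩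
    ∑[ ω ← Ω ] ∑[ X ← cube ] ∑[ c ← codes ] (2 ^ agree X (decode ω c))
      ≡⟨ ∑-cong Ω (λ ω → ∑-swap cube codes _) ⟩
    ∑[ ω ← Ω ] ∑[ c ← codes ] ∑[ X ← cube ] (2 ^ agree X (decode ω c))
      ≡⟨ ∑-cong Ω (λ ω → ∑-cong codes (λ c → ∑-2^agree k (decode ω c))) ⟩
    ∑[ ω ← Ω ] ∑[ c ← codes ] (3 ^ k)
      ≡⟨ ∑-cong Ω (λ ω → ∑-const codes _) ⟩
    ∑[ ω ← Ω ] (length codes * 3 ^ k)
      ≡⟨ ∑-const Ω _ ⟩
    S * (length codes * 3 ^ k) ∎)
    where
    open ≤-Reasoning
    k t S : ℕ
    k = 3 * j
    t = 2 * j
    S = length Ω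

    cube : List (Vec Bool k)
    cube = words bools k

    score : W → Vec Bool k → ℕ
    score ω X = agree X (decode ω (encode ω X))

    rearrange : ∀ a b c → a * (b * c) ≡ c * (b * a)
    rearrange = solve-∀

    -- Success probability 2/3 on each of `3 * j` bits means at least `t = 2 * j` agreements on
    -- average over `ω`; taking a multiple of 3 keeps `t` integral.
    total : ∀ X → S * t ≤ ∑[ ω ← Ω ] score ω X
    total X = *-cancelˡ-≤ 3 (begin
      3 * (S * (2 * j))
        ≡⟨ regroup S j ⟩
      k * (2 * S)
        ≡⟨ cong (_* (2 * S)) (length-allFin k) ⟨
      length (allFin k) * (2 * S)
        ≡⟨ ∑-const (allFin k) (2 * S) ⟨
      ∑[ i ← allFin k ] (2 * S)
        ≤⟨ ∑-mono (allFin k) (correct X) ⟩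
      ∑[ i ← allFin k ] (3 * ∑[ ω ← Ω ] match (lookup X i) (decode ω (encode ω X) i))
        ≡⟨ ∑-*ˡ (allFin k) 3 _ ⟩
      3 * ∑[ i ← allFin k ] ∑[ ω ← Ω ] match (lookup X i) (decode ω (encode ω X) i)
        ≡⟨ cong (3 *_) (∑-swap (allFin k) Ω _) ⟩
      3 * ∑[ ω ← Ω ] score ω X ∎)
      where
      regroup : ∀ S j → 3 * (S * (2 * j)) ≡ 3 * j * (2 * S)
      regroup = solve-∀
      length-allFin : ∀ n → length (allFin n) ≡ n
      length-allFin n = length-tabulate {n = n} (λ i → i)

    -- Jensen's inequality for powers of 2: `2^-convex` at the fixed point `t` is summed over `Ω`,
    -- and `total` bounds the linear part.
    average : ∀ X → 2 ^ t * S ≤ ∑[ ω ← Ω ] (2 ^ score ω X)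
    average X = +-cancelʳ-≤ (S * (t * 2 ^ t)) _ _ (begin
      2 ^ t * S + S * (t * 2 ^ t)
        ≡⟨ regroup (2 ^ t) S t ⟩
      2 ^ t * (S * 1 + S * t)
        ≤⟨ *-monoʳ-≤ (2 ^ t) (+-monoʳ-≤ (S * 1) (total X)) ⟩
      2 ^ t * (S * 1 + ∑[ ω ← Ω ] score ω X)
        ≡⟨ cong (λ s → 2 ^ t * (s + ∑[ ω ← Ω ] score ω X)) (∑-const Ω 1) ⟨
      2 ^ t * (∑[ ω ← Ω ] 1 + ∑[ ω ← Ω ] score ω X)
        ≡⟨ cong (2 ^ t *_) (∑-+ Ω (λ _ → 1) (λ ω → score ω X)) ⟨
      2 ^ t * ∑[ ω ← Ω ] (1 + score ω X)
        ≡⟨ ∑-*ˡ Ω (2 ^ t) _ ⟨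
      ∑[ ω ← Ω ] (2 ^ t * (1 + score ω X))
        ≤⟨ ∑-mono Ω (λ ω → 2^-convex t (score ω X)) ⟩
      ∑[ ω ← Ω ] (2 ^ score ω X + t * 2 ^ t)
        ≡⟨ ∑-+ Ω _ _ ⟩
      ∑[ ω ← Ω ] (2 ^ score ω X) + ∑[ ω ← Ω ] (t * 2 ^ t)
        ≡⟨ cong (∑[ ω ← Ω ] (2 ^ score ω X) +_) (∑-const Ω _) ⟩
      ∑[ ω ← Ω ] (2 ^ score ω X) + S * (t * 2 ^ t) ∎)
      where
      regroup : ∀ x S t → x * S + S * (t * x) ≡ x * (S * 1 + S * t)
      regroup = solve-∀

  -- 2 · 27⁵ ≤ 32⁵ is where the factor 5 in j = 5l comes from.
  code-length-bound : ∀ l e N → N ≤ 2 ^ e →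
    2 ^ (2 * (5 * l)) * 2 ^ (3 * (5 * l)) ≤ N * 3 ^ (3 * (5 * l)) → l ≤ e
  code-length-bound l e N N≤2^e bound with l ≤? e
  ... | yes l≤e = l≤e
  ... | no  l≰e = contradiction (≤-trans 2^l≤N N≤2^e)
    (<⇒≱ (^-monoʳ-< 2 (s≤s (s≤s z≤n)) (≰⇒> l≰e)))
    where
    open ≤-Reasoning
    pow : ∀ b m → b ^ (m * (5 * l)) ≡ (b ^ (m * 5)) ^ l
    pow b m = trans (cong (b ^_) (sym (*-assoc m 5 l))) (sym (^-*-assoc b (m * 5) l))
    *-^ : ∀ a b n → (a * b) ^ n ≡ a ^ n * b ^ n
    *-^ a b zero = refl
    *-^ a b (suc n) = trans (cong (a * b *_) (*-^ a b n)) (interchange a b (a ^ n) (b ^ n))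
      where
      interchange : ∀ a b c d → a * b * (c * d) ≡ a * c * (b * d)
      interchange = solve-∀
    -- In terms of `l` the bound says that the power `l` of `2^25 / 3^15` is at most `N`, and this
    -- base is at least 2.
    2^l≤N : 2 ^ l ≤ N
    2^l≤N = *-cancelʳ-≤ _ _ ((3 ^ 15) ^ l) {{m^n≢0 (3 ^ 15) l}} (begin
      2 ^ l * (3 ^ 15) ^ l                   ≡⟨ *-^ 2 (3 ^ 15) l ⟨
      (2 * 3 ^ 15) ^ l                       ≤⟨ ^-monoˡ-≤ l (≤ᵇ⇒≤ (2 * 3 ^ 15) (2 ^ 10 * 2 ^ 15) _) ⟩
      (2 ^ 10 * 2 ^ 15) ^ l                  ≡⟨ *-^ (2 ^ 10) (2 ^ 15) l ⟩
      (2 ^ 10) ^ l * (2 ^ 15) ^ l            ≡⟨ cong₂ _*_ (pow 2 2) (pow 2 3) ⟨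
      2 ^ (2 * (5 * l)) * 2 ^ (3 * (5 * l))  ≤⟨ bound ⟩
      N * 3 ^ (3 * (5 * l))                  ≡⟨ cong (N *_) (pow 3 3) ⟩
      N * (3 ^ 15) ^ l                       ∎)

-- Networks and their executions

module Networks where
  open import Data.Nat
  open import Data.Nat.Properties
  open import Data.List using (_++_)

  open Index

  -- Counting messages.

  messages : ∀ B → List (Message B)
  messages zero    = ([] Vec≤., z≤n) ∷ []
  messages (suc B) = map (≤-cast (n≤1+n B)) (messages B) ++ map fromVec (words bools (suc B))

  ∈-messages : ∀ B (m : Message B) → m ∈ˡ messages B
  ∈-messages B m@(v Vec≤., _) = vec∈ B v (isBounded m)
    where
    -- The length bound stored in a message is irrelevant. `isBounded` recovers it, so that the
    -- induction can split on whether the length is below `suc B` or equal to it.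
    vec∈ : ∀ B {l} (v : Vec Bool l) (l≤B : l ≤ B) → (v Vec≤., l≤B) ∈ˡ messages B
    vec∈ zero    []    z≤n  = here refl
    vec∈ (suc B) v     l≤1+B with m≤n⇒m<n∨m≡n l≤1+B
    ... | inj₁ (s≤s l≤B) = ∈-++⁺ˡ (∈-map⁺ (≤-cast (n≤1+n B)) (vec∈ B v l≤B))
    ... | inj₂ refl      =
      ∈-++⁺ʳ (map (≤-cast (n≤1+n B)) (messages B)) (∈-map⁺ fromVec (∈-words ∈-bools v))

  -- Messages may be shorter than `B` bits, so there are `2^(B+1) - 1` of them. Hence a message
  -- costs `suc B` bits rather than `B`.
  length-messages : ∀ B → length (messages B) ≤ 2 ^ suc B
  length-messages zero    = s≤s z≤n
  length-messages (suc B) = begin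
    length (messages (suc B))
      ≡⟨ length-++ (map (≤-cast (n≤1+n B)) (messages B)) ⟩
    length (map (≤-cast (n≤1+n B)) (messages B)) + length (map fromVec (words bools (suc B)))
      ≡⟨ cong₂ _+_ (length-map _ (messages B))
           (trans (length-map fromVec (words bools (suc B))) (length-words bools (suc B))) ⟩
    length (messages B) + 2 ^ suc B
      ≤⟨ +-monoˡ-≤ (2 ^ suc B) (length-messages B) ⟩
    2 ^ suc B + 2 ^ suc B
      ≡⟨ cong (2 ^ suc B +_) (+-identityʳ (2 ^ suc B)) ⟨
    2 ^ suc (suc B) ∎
    where open ≤-Reasoning

  private
    variable
      m n : ℕ

  -- The networks and their copies of `H`.

  pattern source x = suc (suc (suc x))

  -- Alice 0F and Bob 1F both point to the sink 2F; P and Q are the sets of the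
  -- remaining vertices, the sources, that point to Alice and to Bob.
  sinkNbrs : Subset (3 + m)
  sinkNbrs = inside ∷ inside ∷ outside ∷ ⊥

  network : Subset m → Subset m → Digraph (3 + m)
  network {m} P Q = record { adj = adj ; loopless = loopless }
    where
    adj : Vec (Subset (3 + m)) (3 + m)
    adj = (outside ∷ outside ∷ outside ∷ P)
        ∷ (outside ∷ outside ∷ outside ∷ Q)
        ∷ sinkNbrs
        ∷ replicate m ⊥

    loopless : ∀ v → v ∉ lookup adj v
    loopless 0F                  ()
    loopless 1F                  (there ())
    loopless 2F                  (there (there ()))
    loopless (source x) x∈ = ∉⊥ (subst (suc (suc (suc x)) ∈_) (lookup-replicate x ⊥) x∈)

  source-∌ : ∀ (P Q : Subset m) {u} x → ¬ Edge (network P Q) u (source x)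
  source-∌ P Q {u} x u∈ = ∉⊥ (subst (u ∈_) (lookup-replicate x ⊥) u∈)

  -- The copy is the diamond from `q` through Alice and Bob to the sink.
  contains-H : ∀ {P Q : Subset m} q → q ∈ P → q ∈ Q → Contains H (network P Q)
  contains-H {m} {P} {Q} q q∈P q∈Q = f , f-injective , f-edge
    where
    f : Fin 4 → Fin (3 + m)
    f 0F = source q
    f 1F = 0F
    f 2F = 1F
    f 3F = 2F

    f-injective : Injective _≡_ _≡_ f
    f-injective {0F} {0F} _ = refl
    f-injective {1F} {1F} _ = refl
    f-injective {2F} {2F} _ = refl
    f-injective {3F} {3F} _ = refl
    f-injective {0F} {1F} ()
    f-injective {0F} {2F} ()
    f-injective {0F} {3F} ()
    f-injective {1F} {0F} ()
    f-injective {1F} {2F} ()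
    f-injective {1F} {3F} ()
    f-injective {2F} {0F} ()
    f-injective {2F} {1F} ()
    f-injective {2F} {3F} ()
    f-injective {3F} {0F} ()
    f-injective {3F} {1F} ()
    f-injective {3F} {2F} ()

    f-edge : ∀ u v → Edge H u v → Edge (network P Q) (f u) (f v)
    f-edge u 0F u∈ = contradiction u∈ ∉⊥
    f-edge u 1F u∈ with refl ← x∈⁅y⁆⇒x≡y 0F u∈ = there (there (there q∈P))
    f-edge u 2F u∈ with refl ← x∈⁅y⁆⇒x≡y 0F u∈ = there (there (there q∈Q))
    f-edge 1F 3F _ = here
    f-edge 2F 3F _ = there here
    f-edge 0F 3F ()
    f-edge 3F 3F (there (there (there ())))

  -- Only the sink has in-neighbours that have in-neighbours themselves.
  common-source : ∀ {P Q : Subset m} → Contains H (network P Q) → ∃[ q ] q ∈ P × q ∈ Q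
  common-source {m} {P} {Q} (f , f-injective , f-edge) =
    diamond (f 0F) (f 1F) (f 2F) (f 3F) (λ eq → contradiction (f-injective eq) λ ())
      (f-edge 0F 1F here) (f-edge 0F 2F here)
      (f-edge 1F 3F (there here)) (f-edge 2F 3F (there (there here)))
    where
    _⟶_ : Fin (3 + m) → Fin (3 + m) → Set
    _⟶_ = Edge (network P Q)

    diamond : ∀ a b c d → b ≢ c → a ⟶ b → a ⟶ c → b ⟶ d → c ⟶ d → ∃[ q ] q ∈ P × q ∈ Q
    -- The two surviving cases: `d` is the sink, `b` and `c` are Alice and Bob in either order, and
    -- `a` is the common source. All others contradict `b ≢ c` or use an edge that does not exist.
    diamond _ 0F 1F 2F _ (there (there (there {i = q} q∈P))) (there (there (there q∈Q))) _ _ = q , q∈P , q∈Q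
    diamond _ 1F 0F 2F _ (there (there (there {i = q} q∈Q))) (there (there (there q∈P))) _ _ = q , q∈P , q∈Q
    diamond a 0F 0F 2F b≢c _ _ _ _ = contradiction refl b≢c
    diamond a 1F 1F 2F b≢c _ _ _ _ = contradiction refl b≢c
    diamond a 2F c 2F _ _ _ (there (there ())) _
    diamond a b 2F 2F _ _ _ _ (there (there ()))
    diamond a (source x) c 2F _ _ _ (there (there (there x∈⊥))) _ = contradiction x∈⊥ ∉⊥
    diamond a b (source x) 2F _ _ _ _ (there (there (there x∈⊥))) = contradiction x∈⊥ ∉⊥
    diamond a (source x) c 0F _ a⟶b _ _ _ = contradiction a⟶b (source-∌ P Q x)
    diamond a (source x) c 1F _ a⟶b _ _ _ = contradiction a⟶b (source-∌ P Q x)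
    diamond a 0F c 0F _ _ _ () _
    diamond a 1F c 0F _ _ _ (there ()) _
    diamond a 2F c 0F _ _ _ (there (there ())) _
    diamond a 0F c 1F _ _ _ () _
    diamond a 1F c 1F _ _ _ (there ()) _
    diamond a 2F c 1F _ _ _ (there (there ())) _
    diamond a b c (source x) _ _ _ b⟶d _ = contradiction b⟶d (source-∌ P Q x)

  -- Edge counts and distance.

  ∣E∣-network : ∀ (P Q : Subset m) → ∣E∣ (network P Q) ≡ ∣ P ∣ + (∣ Q ∣ + 2)
  ∣E∣-network {m} P Q =
    cong (λ e → ∣ P ∣ + (∣ Q ∣ + suc (suc e))) (cong₂ _+_ (∣⊥∣≡0 m) (no-edges m λ x →
      trans (cong ∣_∣ (lookup-replicate x ⊥)) (∣⊥∣≡0 (3 + m))))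
    where
    no-edges : ∀ k {f : Fin k → ℕ} → (∀ x → f x ≡ 0) → Vec.sum (tabulate f) ≡ 0
    no-edges zero    f≗0 = refl
    no-edges (suc k) f≗0 = cong₂ _+_ (f≗0 zero) (no-edges k (f≗0 ∘ suc))

  f[i]≤sum : ∀ (f : Fin n → ℕ) i → f i ≤ Vec.sum (tabulate f)
  f[i]≤sum f zero    = m≤m+n _ _
  f[i]≤sum f (suc i) = ≤-trans (f[i]≤sum (f ∘ suc) i) (m≤n+m _ _)

  lost-edge⇒dist≥1 : ∀ (G G′ : Digraph n) u v → Edge G u v → ¬ Edge G′ u v → 1 ≤ dist G G′
  lost-edge⇒dist≥1 G G′ u v u∈G u∉G′ = begin
    1                                ≡⟨ ∣⁅x⁆∣≡1 u ⟨
    ∣ ⁅ u ⁆ ∣                        ≤⟨ p⊆q⇒∣p∣≤∣q∣ ⁅u⁆⊆lost ⟩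
    ∣ inNbrs G v ─ inNbrs G′ v ∣     ≤⟨ m≤m+n _ _ ⟩
    _                                ≤⟨ f[i]≤sum _ v ⟩
    dist G G′ ∎
    where
    open ≤-Reasoning
    ⁅u⁆⊆lost : ∀ {x} → x ∈ ⁅ u ⁆ → x ∈ inNbrs G v ─ inNbrs G′ v
    ⁅u⁆⊆lost x∈ with refl ← x∈⁅y⁆⇒x≡y u x∈ = x∈p∧x∉q⇒x∈p─q u∈G u∉G′

  -- At distance 0 every edge of the copy of `F` would survive in `G′`. Distance 1 is enough for
  -- farness once ε times the number of edges is at most 1.
  dist-Free≥1 : ∀ (F : Digraph m) (G G′ : Digraph n) → Contains F G → Free F G′ → 1 ≤ dist G G′
  dist-Free≥1 F G G′ (f , f-injective , f-edge) free with dist G G′ in eq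
  ... | suc _ = s≤s z≤n
  ... | zero  = ⊥-elim (free (f , f-injective , kept))
    where
    kept : ∀ u v → Edge F u v → Edge G′ (f u) (f v)
    kept u v uv with f u ∈? inNbrs G′ (f v)
    ... | yes e = e
    ... | no ¬e = contradiction (subst (1 ≤_) eq (lost-edge⇒dist≥1 G G′ _ _ (f-edge u v uv) ¬e)) λ ()

  -- Simulating an execution from Alice's code.

  gather : ∀ {a} {A : Set a} → Subset n → (Fin n → A) → Vec (Maybe A) n
  gather p msg = tabulate λ u → if does (u ∈? p) then just (msg u) else nothing

  -- Inboxes of real executions and of the simulated sink both have the form `gather`, and messages
  -- from outside `p` never enter it.
  gather-cong : ∀ {a} {A : Set a} {p p′ : Subset n} {msg msg′ : Fin n → A} → p ≡ p′ →
                (∀ u → u ∈ p → msg u ≡ msg′ u) → gather p msg ≡ gather p′ msg′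
  gather-cong {p = p} {msg = msg} {msg′} refl eq = tabulate-cong entry
    where
    entry : ∀ u → (if does (u ∈? p) then just (msg u) else nothing)
                ≡ (if does (u ∈? p) then just (msg′ u) else nothing)
    entry u with u ∈? p
    ... | yes u∈p = cong just (eq u u∈p)
    ... | no  _   = refl

  module Decoding {m B T} (A : Algorithm (3 + m) B T) where
    open Algorithm A

    Seeds : Set
    Seeds = Fin (3 + m) → Fin seeds

    module _ (ω : Seeds) where

      -- Induction on rounds: besides its identifier and seed, a node sees only its in-neighbourhood
      -- and its in-neighbours' messages. For sources the second hypothesis is vacuous; their states
      -- then supply it for Alice and Bob.
      state-local : ∀ {G G′ v} → inNbrs G v ≡ inNbrs G′ v →
                    (∀ t u → Edge G u v → state G ω t u ≡ state G′ ω t u) →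
                    ∀ t → state G ω t v ≡ state G′ ω t v
      state-local {v = v} nbrs≡ eq zero    = cong (λ p → init v p (ω v)) nbrs≡
      state-local nbrs≡ eq (suc t) = cong₂ receive (state-local nbrs≡ eq t)
        (gather-cong nbrs≡ (λ u u∈ → cong send (eq t u u∈)))

      source-state : ∀ {P Q P′ Q′ : Subset m} t x →
        state (network P Q) ω t (source x) ≡ state (network P′ Q′) ω t (source x)
      source-state {P} {Q} t x = state-local refl (λ _ _ u∈ → contradiction u∈ (source-∌ P Q x)) t

      alice-state : ∀ {P Q Q′ : Subset m} t → state (network P Q) ω t 0F ≡ state (network P Q′) ω t 0F
      alice-state = state-local refl λ { t _ (there (there (there {i = x} _))) → source-state t x }

      bob-state : ∀ {P P′ Q : Subset m} t → state (network P Q) ω t 1F ≡ state (network P′ Q) ω t 1F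
      bob-state = state-local refl λ { t _ (there (there (there {i = x} _))) → source-state t x }

      -- The most recent message comes first.
      transcript : Subset m → ∀ t → Vec (Message B) t
      transcript P zero    = []
      transcript P (suc t) = send (state (network P ⊥) ω t 0F) ∷ transcript P t

      module _ (Q : Subset m) where

        -- The decoder does not know `P`: Alice's message is given, and the other senders are run
        -- with `⊥` in its place. The entry at the sink itself may be wrong, but `sinkNbrs` discards
        -- it.
        received : ∀ t → Message B → Fin (3 + m) → Message B
        received t msg 0F      = msg
        received t msg (suc u) = send (state (network ⊥ Q) ω t (suc u))

        simulate : ∀ {t} → Vec (Message B) t → State
        simulate []                  = init 2F sinkNbrs (ω 2F)
        simulate (_∷_ {t} msg msgs)  = receive (simulate msgs) (gather sinkNbrs (received t msg))

        simulate-transcript : ∀ P t → simulate (transcript P t) ≡ state (network P Q) ω t 2F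
        simulate-transcript P zero    = refl
        simulate-transcript P (suc t) =
          cong₂ receive (simulate-transcript P t) (gather-cong refl same)
          where
          same : ∀ u → u ∈ sinkNbrs →
                 received t (send (state (network P ⊥) ω t 0F)) u ≡ send (state (network P Q) ω t u)
          same 0F                  _ = cong send (alice-state t)
          same 1F                  _ = cong send (bob-state t)
          same 2F                  (there (there ()))
          same (source x) _ = cong send (source-state t x)

        decodeOutput : Bool × Vec (Message B) T → Fin (3 + m) → Bool
        decodeOutput (b , msgs) 0F = b
        decodeOutput (b , msgs) 1F = output (network ⊥ Q) ω 1F
        decodeOutput (b , msgs) 2F = accept (simulate msgs)
        decodeOutput (b , msgs) v  = output (network ⊥ Q) ω v

        rejects? : ∀ c → Dec (∃[ v ] decodeOutput c v ≡ false)
        rejects? c = any? λ v → decodeOutput c v Bool.≟ false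

      -- Alice does not know `Q` and runs with `⊥` instead, which by `alice-state` leaves her
      -- behaviour unchanged. Her verdict is included because the messages need not determine it.
      encode : Subset m → Bool × Vec (Message B) T
      encode P = output (network P ⊥) ω 0F , transcript P T

      decodeOutput-encode : ∀ P Q v → decodeOutput Q (encode P) v ≡ output (network P Q) ω v
      decodeOutput-encode P Q 0F = cong accept (alice-state T)
      decodeOutput-encode P Q 1F = cong accept (bob-state T)
      decodeOutput-encode P Q 2F = cong accept (simulate-transcript Q P T)
      decodeOutput-encode P Q (source x) = cong accept (source-state T x)

      rejects-encode : ∀ P Q → does (someRejects? (network P Q) ω) ≡ does (rejects? Q (encode P))
      rejects-encode P Q = does-⇔ (mk⇔
        (λ (v , eq) → v , trans (decodeOutput-encode P Q v) eq)
        (λ (v , eq) → v , trans (sym (decodeOutput-encode P Q v)) eq))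
        (someRejects? (network P Q) ω) (rejects? Q (encode P))

      accepts-encode : ∀ P Q → does (allAccept? (network P Q) ω) ≡ not (does (rejects? Q (encode P)))
      accepts-encode P Q = trans
        (does-⇔ (mk⇔ to from) (allAccept? (network P Q) ω) (¬? (someRejects? (network P Q) ω)))
        (cong not (rejects-encode P Q))
        where
        to : AllAccept (network P Q) ω → ¬ SomeRejects (network P Q) ω
        to accepts (v , rejects) = contradiction (trans (sym (accepts v)) rejects) λ ()
        from : ¬ SomeRejects (network P Q) ω → AllAccept (network P Q) ω
        from ¬rejects v with output (network P Q) ω v in eq
        ... | true  = refl
        ... | false = contradiction (v , eq) ¬rejects

    codes : List (Bool × Vec (Message B) T)
    codes = cartesianProduct bools (words (messages B) T)

    ∈-codes : ∀ c → c ∈ˡ codes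
    ∈-codes (b , msgs) = ∈-cartesianProductWith⁺ _,_ (∈-bools b) (∈-words (∈-messages B) msgs)

    -- One bit for Alice's verdict and `suc B` bits for each of her `T` messages.
    length-codes : length codes ≤ 2 ^ (1 + suc B * T)
    length-codes = begin
      length codes                         ≡⟨ length-product _,_ bools (words (messages B) T) ⟩
      2 * length (words (messages B) T)    ≡⟨ cong (2 *_) (length-words (messages B) T) ⟩
      2 * length (messages B) ^ T          ≤⟨ *-monoʳ-≤ 2 (^-monoˡ-≤ T (length-messages B)) ⟩
      2 * (2 ^ suc B) ^ T                  ≡⟨ cong (2 *_) (^-*-assoc 2 (suc B) T) ⟩
      2 * 2 ^ (suc B * T)                  ∎
      where open ≤-Reasoning

open Index
open Networks
open import Data.Integer using (+_; +[1+_])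
open import Data.Rational using (_*_; _≤_; _/_)
open import Data.Vec using (_++_)

-- Rational arithmetic and the reduction

toℚᵘ-/ : ∀ i n → toℚᵘ (i / suc n) ℚᵘ.≃ mkℚᵘ i n
toℚᵘ-/ i n = ℚ.toℚᵘ-fromℚᵘ (mkℚᵘ i n)

/-cancel-≤ : ∀ a b c d .{{_ : NonZero b}} .{{_ : NonZero d}} →
             + a / b ≤ + c / d → a ℕ.* d ℕ.≤ c ℕ.* b
/-cancel-≤ a (suc b) c (suc d) a/b≤c/d = ℤ.drop‿+≤+
  (subst₂ ℤ._≤_ (sym (ℤ.pos-* a (suc d))) (sym (ℤ.pos-* c (suc b)))
    (ℚᵘ.drop-*≤* (begin
      mkℚᵘ (+ a) b          ≃⟨ toℚᵘ-/ (+ a) b ⟨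
      toℚᵘ (+ a / suc b)    ≤⟨ ℚ.toℚᵘ-mono-≤ a/b≤c/d ⟩
      toℚᵘ (+ c / suc d)    ≃⟨ toℚᵘ-/ (+ c) d ⟩
      mkℚᵘ (+ c) d          ∎)))
  where open ℚᵘ.≤-Reasoning

/-mono-≤ : ∀ a b c d .{{_ : NonZero b}} .{{_ : NonZero d}} →
           a ℕ.* d ℕ.≤ c ℕ.* b → + a / b ≤ + c / d
/-mono-≤ a (suc b) c (suc d) ad≤cb = ℚ.toℚᵘ-cancel-≤ (begin
  toℚᵘ (+ a / suc b)    ≃⟨ toℚᵘ-/ (+ a) b ⟩
  mkℚᵘ (+ a) b          ≤⟨ *≤* (subst₂ ℤ._≤_ (ℤ.pos-* a (suc d)) (ℤ.pos-* c (suc b)) (ℤ.+≤+ ad≤cb)) ⟩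
  mkℚᵘ (+ c) d          ≃⟨ toℚᵘ-/ (+ c) d ⟨
  toℚᵘ (+ c / suc d)    ∎)
  where open ℚᵘ.≤-Reasoning

/-*-fromℕ : ∀ a b c .{{_ : NonZero b}} → (+ a / b) * fromℕ c ≡ + (a ℕ.* c) / b
/-*-fromℕ a (suc b) c = ℚ.toℚᵘ-injective (begin
  toℚᵘ ((+ a / suc b) * fromℕ c)           ≈⟨ ℚ.toℚᵘ-homo-* (+ a / suc b) (fromℕ c) ⟩
  toℚᵘ (+ a / suc b) ℚᵘ.* toℚᵘ (fromℕ c)   ≈⟨ ℚᵘ.*-cong (toℚᵘ-/ (+ a) b) (toℚᵘ-/ (+ c) 0) ⟩
  mkℚᵘ (+ a) b ℚᵘ.* mkℚᵘ (+ c) 0           ≈⟨ *≡* (cong₂ ℤ._*_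
    (sym (ℤ.pos-* a c)) (cong (+_) (sym (ℕ.*-identityʳ (suc b))))) ⟩
  mkℚᵘ (+ (a ℕ.* c)) b                     ≈⟨ toℚᵘ-/ (+ (a ℕ.* c)) b ⟨
  toℚᵘ (+ (a ℕ.* c) / suc b)               ∎)
  where open import Relation.Binary.Reasoning.Setoid ℚᵘ.≃-setoid

-- Probabilities as counts of seed assignments.

count-tabulate : ∀ {A : Set} {P : Pred A 0ℓ} (P? : Decidable P) {N} (f : Fin N → A) →
  count P? (tabulate f) ≡ ∑[ x ← List.tabulate f ] (if does (P? x) then 1 else 0)
count-tabulate P? {zero}  f = refl
count-tabulate P? {suc N} f with does (P? (f zero))
... | true  = cong suc (count-tabulate P? (f ∘ suc))
... | false = count-tabulate P? (f ∘ suc)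

-- Clearing denominators gives the counting form of success that `index-bound` asks for.
2/3≤Pr : ∀ {n s} .{{_ : NonZero s}} {P : Pred (Fin n → Fin s) 0ℓ} (P? : Decidable P) →
  + 2 / 3 ≤ Pr P? →
  2 ℕ.* s ℕ.^ n ℕ.≤ 3 ℕ.* ∑[ ω ← allFin (s ℕ.^ n) ] (if does (P? (finToFun ω)) then 1 else 0)
2/3≤Pr {n} {s} P? 2/3≤ = begin
  2 ℕ.* s ℕ.^ n   ≤⟨ /-cancel-≤ 2 3 (count P?∘ω (Vec.allFin (s ℕ.^ n))) (s ℕ.^ n) {{_}} {{ℕ.m^n≢0 s n}} 2/3≤ ⟩
  count P?∘ω (Vec.allFin (s ℕ.^ n)) ℕ.* 3  ≡⟨ ℕ.*-comm (count P?∘ω (Vec.allFin (s ℕ.^ n))) 3 ⟩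
  3 ℕ.* count P?∘ω (Vec.allFin (s ℕ.^ n))  ≡⟨ cong (3 ℕ.*_) (count-tabulate P?∘ω id) ⟩
  3 ℕ.* ∑[ ω ← allFin (s ℕ.^ n) ] (if does (P? (finToFun ω)) then 1 else 0) ∎
  where
  open ℕ.≤-Reasoning
  P?∘ω = λ ω → P? (finToFun ω)

∣p++⊥∣≤ : ∀ {k} r (p : Subset k) → ∣ p ++ ⊥ {r} ∣ ℕ.≤ k
∣p++⊥∣≤ r Vec.[]            = ℕ.≤-reflexive (∣⊥∣≡0 r)
∣p++⊥∣≤ r (inside Vec.∷ p)  = s≤s (∣p++⊥∣≤ r p)
∣p++⊥∣≤ r (outside Vec.∷ p) = ℕ.m≤n⇒m≤1+n (∣p++⊥∣≤ r p)

-- X ⊆ [15l] is Alice's input and i is Bob's; they are turned into networks in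
-- which i is a source of both players iff i ∈ X.
module Reduction (l r : ℕ) {B T : ℕ} {ε : ℚ}
  (A : Algorithm (3 ℕ.+ (3 ℕ.* (5 ℕ.* l) ℕ.+ r)) B T)
  (ε-small : ∀ e → e ℕ.≤ 3 ℕ.* (5 ℕ.* l) ℕ.+ 3 → ε * fromℕ e ≤ fromℕ 1)
  (tests : Tests A H ε)
  where

  open Algorithm A
  open Decoding A
  open Tests tests

  k n : ℕ
  k = 3 ℕ.* (5 ℕ.* l)
  n = 3 ℕ.+ (k ℕ.+ r)

  -- The last `r` sources stay isolated: they pad the network to a prescribed size without adding
  -- edges.
  alice : Vec Bool k → Subset (k ℕ.+ r)
  alice X = X ++ ⊥

  bob : Fin k → Subset (k ℕ.+ r)
  bob i = ⁅ i ↑ˡ r ⁆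

  instance
    seedings≢0 : NonZero (seeds ℕ.^ n)
    seedings≢0 = ℕ.m^n≢0 seeds n

  -- Alice has at most `k` incoming edges, Bob one and the sink two. By `ε-small`, farness then only
  -- demands distance at least 1, which the copy of `H` forces.
  far : ∀ X i → lookup X i ≡ true → Far ε H (network (alice X) (bob i))
  far X i i∈X = subst NonZero (sym edges) (ℕ.>-nonZero (ℕ.<-≤-trans (s≤s z≤n) (ℕ.m≤n+m 3 _))) ,
    λ G′ free → ℚ.≤-trans
      (ε-small _ (ℕ.≤-trans (ℕ.≤-reflexive edges) (ℕ.+-monoˡ-≤ 3 (∣p++⊥∣≤ r X))))
      (/-mono-≤ 1 1 (dist (network (alice X) (bob i)) G′) 1 (ℕ.*-monoˡ-≤ 1
        (dist-Free≥1 H (network (alice X) (bob i)) G′ contains free)))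
    where
    edges : ∣E∣ (network (alice X) (bob i)) ≡ ∣ alice X ∣ ℕ.+ 3
    edges = trans (∣E∣-network (alice X) (bob i))
                  (cong (λ e → ∣ alice X ∣ ℕ.+ (e ℕ.+ 2)) (∣⁅x⁆∣≡1 (i ↑ˡ r)))
    contains : Contains H (network (alice X) (bob i))
    contains = contains-H (i ↑ˡ r)
      (lookup⇒[]= (i ↑ˡ r) (alice X) (trans (lookup-++ˡ X ⊥ i) i∈X)) (x∈⁅x⁆ (i ↑ˡ r))

  free : ∀ X i → lookup X i ≡ false → Free H (network (alice X) (bob i))
  free X i i∉X contains with q , q∈X , q∈i ← common-source contains
    with refl ← x∈⁅y⁆⇒x≡y (i ↑ˡ r) q∈i
    with () ← trans (sym i∉X) (trans (sym (lookup-++ˡ X ⊥ i)) ([]=⇒lookup q∈X))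

  -- Rejection is read as the answer that `i` lies in `X`, since exactly then the network contains
  -- `H`.
  decode : Fin (seeds ℕ.^ n) → Bool × Vec (Message B) T → Fin k → Bool
  decode ω c i = does (rejects? (finToFun ω) (bob i) c)

  correct : ∀ X i → 2 ℕ.* length (allFin (seeds ℕ.^ n)) ℕ.≤
    3 ℕ.* ∑[ ω ← allFin (seeds ℕ.^ n) ] match (lookup X i) (decode ω (encode (finToFun ω) (alice X)) i)
  -- A bit `true` is recovered by soundness on a far network, a bit `false` by completeness on an
  -- `H`-free one.
  correct X i rewrite length-tabulate {n = seeds ℕ.^ n} id with lookup X i in eq
  ... | true  = ℕ.≤-trans (2/3≤Pr (someRejects? _) (sound _ (far X i eq)))
    (ℕ.≤-reflexive (cong (3 ℕ.*_) (∑-cong (allFin _) λ ω →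
      trans (cong (if_then 1 else 0) (rejects-encode (finToFun ω) (alice X) (bob i)))
            (if≡match-true (decode ω (encode (finToFun ω) (alice X)) i)))))
    where
    if≡match-true : ∀ b → (if b then 1 else 0) ≡ match true b
    if≡match-true true  = refl
    if≡match-true false = refl
  ... | false = ℕ.≤-trans (2/3≤Pr (allAccept? _) (complete _ (free X i eq)))
    (ℕ.≤-reflexive (cong (3 ℕ.*_) (∑-cong (allFin _) λ ω →
      trans (cong (if_then 1 else 0) (accepts-encode (finToFun ω) (alice X) (bob i)))
            (if-not≡match-false (decode ω (encode (finToFun ω) (alice X)) i)))))
    where
    if-not≡match-false : ∀ b → (if not b then 1 else 0) ≡ match false b
    if-not≡match-false true  = refl
    if-not≡match-false false = refl

  rounds-bound : l ℕ.≤ 1 ℕ.+ suc B ℕ.* T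
  rounds-bound = code-length-bound l (1 ℕ.+ suc B ℕ.* T) (length codes) length-codes
    (index-bound (5 ℕ.* l) (allFin (seeds ℕ.^ n))
      {{subst NonZero (sym (length-tabulate {n = seeds ℕ.^ n} id)) seedings≢0}}
      codes ∈-codes (λ ω X → encode (finToFun ω) (alice X)) decode correct)

-- For ε = p/q this is l = ⌊1/(18ε)⌋, so that k + 3 = 15l + 3 ≤ 18l ≤ 1/ε.
threshold : ∀ p q .{{_ : NonZero p}} → 36 ℕ.* p ℕ.≤ q →
  ∃[ l ] 2 ℕ.≤ l × l ℕ.* 18 ℕ.* p ℕ.≤ q × q ℕ.≤ suc l ℕ.* 18 ℕ.* p
threshold p q 36p≤q =
  l , 2≤l , ℕ.≤-trans (ℕ.≤-reflexive (ℕ.*-assoc l 18 p)) (m/n*n≤m q (18 ℕ.* p)) , ℕ.<⇒≤ q<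
  where
  open ℕ.≤-Reasoning
  instance
    18p≢0 : NonZero (18 ℕ.* p)
    18p≢0 = ℕ.m*n≢0 18 p

  l : ℕ
  l = q ℕ./ (18 ℕ.* p)

  q< : q ℕ.< suc l ℕ.* 18 ℕ.* p
  q< = begin-strict
    q                                          ≡⟨ m≡m%n+[m/n]*n q (18 ℕ.* p) ⟩
    q ℕ.% (18 ℕ.* p) ℕ.+ l ℕ.* (18 ℕ.* p)      <⟨ ℕ.+-monoˡ-< _ (m%n<n q (18 ℕ.* p)) ⟩
    suc l ℕ.* (18 ℕ.* p)                       ≡⟨ ℕ.*-assoc (suc l) 18 p ⟨
    suc l ℕ.* 18 ℕ.* p                         ∎

  -- The constant 36 is `2 * 18`: from `2 * 18 * p ≤ q < (l + 1) * 18 * p` follows `2 < l + 1`.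
  2≤l : 2 ℕ.≤ l
  2≤l = ℕ.s≤s⁻¹ (ℕ.*-cancelʳ-< 18 2 (suc l) (ℕ.*-cancelʳ-< p 36 (suc l ℕ.* 18) (ℕ.≤-<-trans 36p≤q q<)))

-- For `l ≥ 2` the additive 1 is absorbed by `l + 1 ≤ 3 * (l - 1)`. Together with `B + 1 ≤ 2 * B`
-- this gives `l + 1 ≤ 6 * B * T`, and 108 is `6 * 18`.
rounds-arithmetic : ∀ p {q l} B T .{{_ : NonZero B}} → 2 ℕ.≤ l → q ℕ.≤ suc l ℕ.* 18 ℕ.* p →
  l ℕ.≤ 1 ℕ.+ suc B ℕ.* T → q ℕ.≤ p ℕ.* B ℕ.* T ℕ.* 108
rounds-arithmetic p {q} {suc (suc a)} B@(suc b) T (s≤s (s≤s _)) q≤ l≤ = begin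
  q                                                    ≤⟨ q≤ ⟩
  (3 ℕ.+ a) ℕ.* 18 ℕ.* p                               ≤⟨ ℕ.*-monoˡ-≤ p (ℕ.*-monoˡ-≤ 18 3+a≤6BT) ⟩
  (6 ℕ.* (B ℕ.* T)) ℕ.* 18 ℕ.* p                       ≡⟨ regroup B T p ⟩
  p ℕ.* B ℕ.* T ℕ.* 108                                ∎
  where
  open ℕ.≤-Reasoning
  regroup : ∀ B T p → (6 ℕ.* (B ℕ.* T)) ℕ.* 18 ℕ.* p ≡ p ℕ.* B ℕ.* T ℕ.* 108
  regroup = solve-∀
  triple : ∀ a → 3 ℕ.* suc a ≡ (3 ℕ.+ a) ℕ.+ 2 ℕ.* a
  triple = solve-∀
  double : ∀ B T → 3 ℕ.* ((B ℕ.+ B) ℕ.* T) ≡ 6 ℕ.* (B ℕ.* T)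
  double = solve-∀
  3+a≤6BT : 3 ℕ.+ a ℕ.≤ 6 ℕ.* (B ℕ.* T)
  3+a≤6BT = begin
    3 ℕ.+ a                           ≤⟨ ℕ.m≤m+n (3 ℕ.+ a) (2 ℕ.* a) ⟩
    3 ℕ.+ a ℕ.+ 2 ℕ.* a               ≡⟨ triple a ⟨
    3 ℕ.* suc a                       ≤⟨ ℕ.*-monoʳ-≤ 3 (ℕ.s≤s⁻¹ l≤) ⟩
    3 ℕ.* (suc B ℕ.* T)               ≤⟨ ℕ.*-monoʳ-≤ 3 (ℕ.*-monoˡ-≤ T (s≤s (ℕ.m≤n+m B b))) ⟩
    3 ℕ.* ((B ℕ.+ B) ℕ.* T)           ≡⟨ double B T ⟩
    6 ℕ.* (B ℕ.* T)                   ∎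

/[Bε]-≤ : ∀ B T ε c .{{_ : NonZero B}} .{{_ : Positive ε}} →
  c ≤ (ε * fromℕ B) * fromℕ T → c * 1/[ B * ε ] ≤ fromℕ T
/[Bε]-≤ B T ε c c≤ = begin
  c * 1/x                     ≤⟨ ℚ.*-monoʳ-≤-nonNeg 1/x {{ℚ.pos⇒nonNeg 1/x {{ℚ.1/pos⇒pos x}}}} c≤ ⟩
  ε * fromℕ B * fromℕ T * 1/x ≡⟨ cong (_* 1/x)
    (trans (cong (_* fromℕ T) (ℚ.*-comm ε (fromℕ B))) (ℚ.*-comm x (fromℕ T))) ⟩
  fromℕ T * x * 1/x           ≡⟨ ℚ.*-assoc (fromℕ T) x 1/x ⟩
  fromℕ T * (x * 1/x)         ≡⟨ cong (fromℕ T *_) (ℚ.*-inverseʳ x {{ℚ.pos⇒nonZero x}}) ⟩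
  fromℕ T * ℚ.1ℚ              ≡⟨ ℚ.*-identityʳ (fromℕ T) ⟩
  fromℕ T                     ∎
  where
  open ℚ.≤-Reasoning
  x 1/x : ℚ
  x = fromℕ B * ε
  instance
    x-pos : Positive x
    x-pos = ℚ.pos*pos⇒pos (fromℕ B) {{fromℕ-pos B}} ε
  1/x = 1/[ B * ε ]

-- Writing ε as `p / q` reduces the claim to natural numbers. The upper bound on ε makes `l` at
-- least 2, and `1 ≤ ε * n` makes room for the network: `k + 3 ≤ 18 * l ≤ q / p ≤ n`.
rounds-lower-bound : (n B T : ℕ) (ε : ℚ) .{{_ : NonZero B}} .{{_ : Positive ε}} →
  ε ≤ + 1 / 36 → + 1 / 1 ≤ ε * fromℕ n →
  (A : Algorithm n B T) → Tests A H ε →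
  + 1 / 108 * 1/[ B * ε ] ≤ fromℕ T
rounds-lower-bound n B T ε@(mkℚ +[1+ p-1 ] q-1 coprime) ε≤1/36 1≤εn A tests = conclude
  (threshold p q (subst₂ ℕ._≤_ (ℕ.*-comm p 36) (ℕ.*-identityˡ q)
    (/-cancel-≤ p q 1 36 (subst (_≤ + 1 / 36) ε≡p/q ε≤1/36))))
  where
  p q : ℕ
  p = suc p-1
  q = suc q-1

  ε≡p/q : ε ≡ + p / q
  ε≡p/q = sym (ℚ.normalize-coprime coprime)

  ε*fromℕ : ∀ e → ε * fromℕ e ≡ + (p ℕ.* e) / q
  ε*fromℕ e = trans (cong (_* fromℕ e) ε≡p/q) (/-*-fromℕ p q e)

  q≤np : q ℕ.≤ n ℕ.* p
  q≤np = subst₂ ℕ._≤_ (ℕ.*-identityˡ q) (trans (ℕ.*-identityʳ (p ℕ.* n)) (ℕ.*-comm p n))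
    (/-cancel-≤ 1 1 (p ℕ.* n) q (subst (+ 1 / 1 ≤_) (ε*fromℕ n) 1≤εn))

  conclude : (∃[ l ] 2 ℕ.≤ l × l ℕ.* 18 ℕ.* p ℕ.≤ q × q ℕ.≤ suc l ℕ.* 18 ℕ.* p) →
             + 1 / 108 * 1/[ B * ε ] ≤ fromℕ T
  conclude (l , 2≤l , 18lp≤q , q≤) = /[Bε]-≤ B T ε (+ 1 / 108)
    (subst (+ 1 / 108 ≤_) (sym (trans (cong (_* fromℕ T) (ε*fromℕ B)) (/-*-fromℕ (p ℕ.* B) q T)))
      (/-mono-≤ 1 108 (p ℕ.* B ℕ.* T) q
        (subst (ℕ._≤ p ℕ.* B ℕ.* T ℕ.* 108) (sym (ℕ.*-identityˡ q))
          (rounds-arithmetic p B T 2≤l q≤ (bound A tests (ℕ.m≤n⇒∃[o]m+o≡n 3+k≤n))))))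
    where
    k : ℕ
    k = 3 ℕ.* (5 ℕ.* l)

    k+3≤18l : k ℕ.+ 3 ℕ.≤ l ℕ.* 18
    k+3≤18l = ℕ.≤-trans (ℕ.+-monoʳ-≤ k (ℕ.*-monoʳ-≤ 3 (ℕ.<⇒≤ 2≤l))) (ℕ.≤-reflexive (regroup l))
      where
      regroup : ∀ l → 3 ℕ.* (5 ℕ.* l) ℕ.+ 3 ℕ.* l ≡ l ℕ.* 18
      regroup = solve-∀

    3+k≤n : 3 ℕ.+ k ℕ.≤ n
    3+k≤n = ℕ.≤-trans (ℕ.≤-reflexive (ℕ.+-comm 3 k)) (ℕ.≤-trans k+3≤18l
      (ℕ.*-cancelʳ-≤ (l ℕ.* 18) n p (ℕ.≤-trans 18lp≤q q≤np)))

    ε-small : ∀ e → e ℕ.≤ k ℕ.+ 3 → ε * fromℕ e ≤ fromℕ 1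
    ε-small e e≤ = subst (_≤ fromℕ 1) (sym (ε*fromℕ e)) (/-mono-≤ (p ℕ.* e) q 1 1 (begin
      p ℕ.* e ℕ.* 1     ≡⟨ ℕ.*-identityʳ (p ℕ.* e) ⟩
      p ℕ.* e           ≡⟨ ℕ.*-comm p e ⟩
      e ℕ.* p           ≤⟨ ℕ.*-monoˡ-≤ p (ℕ.≤-trans e≤ k+3≤18l) ⟩
      l ℕ.* 18 ℕ.* p    ≤⟨ 18lp≤q ⟩
      q                 ≡⟨ ℕ.*-identityˡ q ⟨
      1 ℕ.* q           ∎))
      where open ℕ.≤-Reasoning

    -- Abstracting `n` lets the equation be matched with `refl`, so that `r` becomes the number of
    -- padding sources.
    bound : ∀ {n} (A : Algorithm n B T) → Tests A H ε → (∃[ r ] (3 ℕ.+ k) ℕ.+ r ≡ n) →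
            l ℕ.≤ 1 ℕ.+ suc B ℕ.* T
    bound A tests (r , refl) = Reduction.rounds-bound l r {ε = ε} A ε-small tests

mainTheorem10 : ∃[ c ] ∃[ ε₀ ] ∃[ C ] Positive c × Positive ε₀ × Positive C ×
    ((n B T : ℕ) (ε : ℚ) .{{_ : NonZero B}} .{{_ : Positive ε}} →
    ε ≤ ε₀ → C ≤ ε * fromℕ n →
    (A : Algorithm n B T) → Tests A H ε →
    c * 1/[ B * ε ] ≤ fromℕ T)
mainTheorem10 = + 1 / 108 , + 1 / 36 , + 1 / 1 , _ , _ , _ , rounds-lower-bound
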